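{- Let $q$ be an odd prime power and let $\mathcal U_{a,b}$ (with $a\neq 0$) be a non-classical orthogonal Buekenhout-Metz unital in $\mathrm{PG}(2,q^2)$. Let $\{\ell_1,\ell_{ -1},\ell',\ell''\}$ be any O'Nan configuration of $\mathcal U_{a,b}$ arising from the Feng–Li construction for $q$ odd (described in the context). Then this O'Nan configuration cannot be extended to a Triple O'Nan; that is, there is no Triple O'Nan configuration of $\mathcal U_{a,b}$ whose six lines include the four lines $\ell_1,\ell_{ -1},\ell',\ell''$.
   Context: Points of $\mathrm{PG}(2,q^2)$ are written $(x,y,z)$ and lines $[l,m,n]$ (homogeneous coordinates), with incidence $lx+my+nz=0$. For $q$ odd and $a,b\in\mathbb F_{q^2}$ such that $d=(b-b^q)^2+4a^{q+1}$ is a non-square in $\mathbb F_q$, the orthogonal Buekenhout-Metz (BM) unital is $$\mathcal U_{a,b}=\{(x,ax^2+bx^{q+1}+r,1)\mid r\in\mathbb F_q,\ x\in\mathbb F_{q^2}\}\cup\{T_\infty=(0,1,0)\}.$$ It is classical if and only if $a=0$. An O'Nan configuration in a unital $\mathcal U$ is a set of four distinct lines forming a quadrilateral (no three concurrent) whose six pairwise intersection points all lie in $\mathcal U$. A Triple O'Nan configuration of $\mathcal U$ is a set of six lines arising as follows: there is a quadrangle of four points of $\mathcal U$ (no three collinear) such that, for each of the three partitions of the four points into two pairs, the two lines joining the pairs meet in a point of $\mathcal U$; the six lines joining pairs of the four points form the Triple O'Nan. Feng–Li construction for $q$ odd: let $\sigma:(x,y,z)\mapsto(-x,y,z)$, $P=(0,0,1)$,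 $\ell_1=[1,1,0]$, $\ell_{ -1}=[1,-1,0]=\sigma(\ell_1)$. For $\lambda\in\mathbb F_q$ put $$x_\lambda=-\frac{a^q+\lambda-b}{a^{q+1}-(\lambda-b)^{q+1}},\qquad P_\lambda=(x_\lambda,-x_\lambda,1)\in\ell_1\cap\mathcal U_{a,b},\qquad P_\lambda^\sigma=\sigma(P_\lambda).$$ Choose distinct $\lambda_1,\lambda_2\in\mathbb F_q$ with $x_{\lambda_1}+x_{\lambda_2}\ne0$ and $r=-\dfrac{2x_{\lambda_1}x_{\lambda_2}}{x_{\lambda_1}+x_{\lambda_2}}\in\mathbb F_q^*$, and put $R=(0,r,1)\in\mathcal U_{a,b}$. Let $\ell'=P_{\lambda_1}P_{\lambda_2}^\sigma$ and $\ell''=P_{\lambda_1}^\sigma P_{\lambda_2}=\sigma(\ell')$, which meet in $R$. Then $\ell_1=P_{\lambda_1}P_{\lambda_2}$, $\ell_{ -1}=P_{\lambda_1}^\sigma P_{\lambda_2}^\sigma$, $\ell'$, $\ell''$ form an O'Nan configuration with points $P,R,P_{\lambda_1},P_{\lambda_2},P_{\lambda_1}^\sigma,P_{\lambda_2}^\sigma$. -}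

module Defs where

open import Algebra.Apartness.Bundles using (HeytingCommutativeRing)
open import Algebra.Apartness.Structures using (IsHeytingField)
open import Algebra.Bundles using (CommutativeRing)
open import Data.Empty using (⊥-elim)
open import Data.Fin.Base using (Fin)
open import Data.Fin.Properties using (inj⇒≟)
open import Data.Nat.Base as ℕ using (ℕ; suc)
open import Data.Nat.Divisibility using (_∤_)
open import Data.Nat.Primality using (Prime)
open import Data.Product.Base using (∃-syntax; _×_; _,_; proj₁; proj₂)
open import Data.Sum.Base using (_⊎_)
open import Data.Vec.Functional using (Vector; []; _∷_)
open import Function.Bundles using (Inverse)
open import Function.Properties.Inverse using (Inverse⇒Injection)
open import Level using (Level; _⊔_) renaming (suc to lsuc)
open import Relation.Binary.Definitions using (Decidable)
open import Relation.Binary.PropositionalEquality using (_≡_; _≢_; setoid)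
open import Relation.Nullary.Decidable using (yes; no)
open import Relation.Nullary.Negation using (¬_)
open import Relation.Unary using (Pred; _∈_)
import Algebra.Apartness.Properties.HeytingCommutativeRing
import Algebra.Properties.Ring
import Algebra.Properties.Semiring.Exp
import Algebra.Properties.Semiring.Mult

OddPrimePower : ℕ → Set
OddPrimePower q = (∃[ p ] ∃[ k ] (Prime p × q ≡ p ℕ.^ suc k)) × 2 ∤ q

-- With denial inequality as the apartness relation, a Heyting field is a
-- nontrivial commutative ring in which every nonzero element is invertible.
record FiniteField (c ℓ : Level) (order : ℕ) : Set (lsuc (c ⊔ ℓ)) where
  infix  8 -_
  infixl 7 _*_
  infixl 6 _+_
  infix  4 _≈_
  field
    Carrier        : Set c
    _≈_            : Carrier → Carrier → Set ℓ
    _+_ _*_        : Carrier → Carrier → Carrier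
    -_             : Carrier → Carrier
    0# 1#          : Carrier
    isHeytingField :
      IsHeytingField _≈_ (λ x y → ¬ (x ≈ y)) _+_ _*_ -_ 0# 1#

  heytingCommutativeRing : HeytingCommutativeRing c ℓ ℓ
  heytingCommutativeRing = record
    { isHeytingCommutativeRing =
        IsHeytingField.isHeytingCommutativeRing isHeytingField }

  open HeytingCommutativeRing heytingCommutativeRing public
    using (commutativeRing; #⇒invertible; invertible⇒#)

  open CommutativeRing commutativeRing public
    hiding (Carrier; _≈_; _+_; _*_; -_; 0#; 1#)
    renaming (setoid to ≈-setoid)

  field
    enumeration : Inverse ≈-setoid (setoid (Fin order))

module FieldOperations {c ℓ order} (K : FiniteField c ℓ order) where
  open FiniteField K public

  open Algebra.Properties.Semiring.Exp semiring public using (_^_)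
  open Algebra.Properties.Semiring.Mult semiring public
    using () renaming (_×_ to infixr 8 _·_)

  private
    module Ringₚ = Algebra.Properties.Ring ring
    module Heytingₚ =
      Algebra.Apartness.Properties.HeytingCommutativeRing heytingCommutativeRing

  _≟_ : Decidable _≈_
  _≟_ = inj⇒≟ (Inverse⇒Injection enumeration)

  1≉0 : 1# ≉ 0#
  1≉0 = Heytingₚ.1#0

  -x≈0⇒x≈0 : ∀ {x} → - x ≈ 0# → x ≈ 0#
  -x≈0⇒x≈0 {x} -x≈0 =
    trans (sym (Ringₚ.-‿involutive x)) (trans (-‿cong -x≈0) Ringₚ.-0#≈0#)

  infix  9 _⁻¹
  infixl 7 _/_

  -- The value at 0 is a convention.
  _⁻¹ : Carrier → Carrier
  x ⁻¹ with x ≟ 0#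
  ... | yes _   = 0#
  ... | no  x≉0 = proj₁ (#⇒invertible x≉0)

  ⁻¹-inverseʳ : ∀ x → x ≉ 0# → x * x ⁻¹ ≈ 1#
  ⁻¹-inverseʳ x x≉0 with x ≟ 0#
  ... | yes x≈0 = ⊥-elim (x≉0 x≈0)
  ... | no  x≉0′ =
    trans (*-congʳ (sym (Heytingₚ.x-0≈x x))) (proj₂ (proj₂ (#⇒invertible x≉0′)))

  _/_ : Carrier → Carrier → Carrier
  x / y = x * y ⁻¹

module ProjectivePlane {c ℓ order} (K : FiniteField c ℓ order) where
  open FieldOperations K

  record Point : Set (c ⊔ ℓ) where
    constructor point
    field
      x y z   : Carrier
      nonzero : ¬ (x ≈ 0# × y ≈ 0# × z ≈ 0#)

  record Line : Set (c ⊔ ℓ) where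
    constructor line
    field
      l m n   : Carrier
      nonzero : ¬ (l ≈ 0# × m ≈ 0# × n ≈ 0#)

  infix 4 _≈ᵖ_ _≈ˡ_ _on_

  _≈ᵖ_ : Point → Point → Set (c ⊔ ℓ)
  point x y z _ ≈ᵖ point x′ y′ z′ _ =
    ∃[ k ] (k ≉ 0# × x ≈ k * x′ × y ≈ k * y′ × z ≈ k * z′)

  _≈ˡ_ : Line → Line → Set (c ⊔ ℓ)
  line l m n _ ≈ˡ line l′ m′ n′ _ =
    ∃[ k ] (k ≉ 0# × l ≈ k * l′ × m ≈ k * m′ × n ≈ k * n′)

  _on_ : Point → Line → Set ℓ
  point x y z _ on line l m n _ = l * x + m * y + n * z ≈ 0#

  Collinear : Point → Point → Point → Set (c ⊔ ℓ)
  Collinear A B C = ∃[ ℓ₀ ] (A on ℓ₀ × B on ℓ₀ × C on ℓ₀)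

  Concurrent : Line → Line → Line → Set (c ⊔ ℓ)
  Concurrent ℓ₁ ℓ₂ ℓ₃ = ∃[ A ] (A on ℓ₁ × A on ℓ₂ × A on ℓ₃)

  _joins_and_ : Line → Point → Point → Set (c ⊔ ℓ)
  ℓ₀ joins A and B = ¬ (A ≈ᵖ B) × A on ℓ₀ × B on ℓ₀

  record IsONan {u} (𝒰 : Pred Point u) (L : Vector Line 4) : Set (c ⊔ ℓ ⊔ u) where
    field
      distinct      : ∀ i j → i ≢ j → ¬ (L i ≈ˡ L j)
      quadrilateral : ∀ i j k → i ≢ j → i ≢ k → j ≢ k →
                      ¬ Concurrent (L i) (L j) (L k)
      meetIn𝒰       : ∀ i j → i ≢ j →
                      ∃[ A ] (A ∈ 𝒰 × A on L i × A on L j)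

  record TripleONan {u} (𝒰 : Pred Point u) : Set (c ⊔ ℓ ⊔ u) where
    field
      vertex     : Vector Point 4
      vertex∈𝒰   : ∀ i → vertex i ∈ 𝒰
      quadrangle : ∀ i j k → i ≢ j → i ≢ k → j ≢ k →
                   ¬ Collinear (vertex i) (vertex j) (vertex k)
      -- each partition {{i, j}, {k, l}} occurs several times
      diagonal∈𝒰 : ∀ i j k l → i ≢ j → i ≢ k → i ≢ l → j ≢ k → j ≢ l → k ≢ l →
                   ∃[ ℓ₀ ] ∃[ ℓ₁ ] ∃[ D ]
                     ( ℓ₀ joins vertex i and vertex j
                     × ℓ₁ joins vertex k and vertex l
                     × D ∈ 𝒰 × D on ℓ₀ × D on ℓ₁)

    lines : Pred Line (c ⊔ ℓ)
    lines ℓ₀ = ∃[ i ] ∃[ j ] (i ≢ j × ℓ₀ joins vertex i and vertex j)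

  Extends : ∀ {u} {𝒰 : Pred Point u} → TripleONan 𝒰 → Vector Line 4 → Set (c ⊔ ℓ)
  Extends T L = ∀ i → L i ∈ TripleONan.lines T

  affine : Carrier → Carrier → Point
  affine x y = point x y 1# λ (_ , _ , 1≈0) → 1≉0 1≈0

module BuekenhoutMetz {c ℓ} (q : ℕ) (K : FiniteField c ℓ (q ℕ.^ 2)) where
  open FieldOperations K
  open ProjectivePlane K

  -- The subfield of order q of a field of order q² is the fixed field of the
  -- map x ↦ x ^ q.
  𝔽q : Pred Carrier ℓ
  𝔽q x = x ^ q ≈ x

  NonSquareIn𝔽q : Pred Carrier (c ⊔ ℓ)
  NonSquareIn𝔽q d = d ∈ 𝔽q × ¬ (∃[ s ] (s ∈ 𝔽q × s * s ≈ d))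

  discriminant : Carrier → Carrier → Carrier
  discriminant a b = (b - b ^ q) ^ 2 + 4 · a ^ (q ℕ.+ 1)

  T∞ : Point
  T∞ = point 0# 1# 0# λ (_ , 1≈0 , _) → 1≉0 1≈0

  unital : Carrier → Carrier → Pred Point (c ⊔ ℓ)
  unital a b A =
    (∃[ x ] ∃[ r ] (r ∈ 𝔽q ×
       A ≈ᵖ affine x (a * x ^ 2 + b * x ^ (q ℕ.+ 1) + r)))
    ⊎ A ≈ᵖ T∞

  σ : Point → Point
  σ (point x y z nz) =
    point (- x) y z λ (-x≈0 , y≈0 , z≈0) → nz (-x≈0⇒x≈0 -x≈0 , y≈0 , z≈0)

  ℓ₁ : Line
  ℓ₁ = line 1# 1# 0# λ (1≈0 , _) → 1≉0 1≈0

  ℓ₋₁ : Line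
  ℓ₋₁ = line 1# (- 1#) 0# λ (1≈0 , _) → 1≉0 1≈0

  module _ (a b : Carrier) where

    -- The denominator vanishes for no λ ∈ 𝔽q when the discriminant is a
    -- non-square: it is zero only if (2 · λ - (b + b ^ q)) ^ 2 equals the
    -- discriminant.
    x[_] : Carrier → Carrier
    x[ λ₀ ] = - ((a ^ q + λ₀ - b) / (a ^ (q ℕ.+ 1) - (λ₀ - b) ^ (q ℕ.+ 1)))

    P[_] : Carrier → Point
    P[ λ₀ ] = affine x[ λ₀ ] (- x[ λ₀ ])

    record FengLi : Set (c ⊔ ℓ) where
      field
        λ₁ λ₂    : Carrier
        λ₁∈𝔽q    : λ₁ ∈ 𝔽q
        λ₂∈𝔽q    : λ₂ ∈ 𝔽q
        distinct : λ₁ ≉ λ₂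
        sum≉0    : x[ λ₁ ] + x[ λ₂ ] ≉ 0#

      r : Carrier
      r = - ((2 · (x[ λ₁ ] * x[ λ₂ ])) / (x[ λ₁ ] + x[ λ₂ ]))

      field
        r∈𝔽q : r ∈ 𝔽q
        r≉0  : r ≉ 0#
        ℓ′ ℓ″ : Line
        ℓ′-join : ℓ′ joins P[ λ₁ ] and σ P[ λ₂ ]
        ℓ″-join : ℓ″ joins σ P[ λ₁ ] and P[ λ₂ ]

      lines : Vector Line 4
      lines = ℓ₁ ∷ ℓ₋₁ ∷ ℓ′ ∷ ℓ″ ∷ []

{-# OPTIONS --safe #-}

-- Write x₁, x₂ for the coordinates of P_λ₁, P_λ₂.  Four of the six lines of a
-- Triple O'Nan no three of which are concurrent form a 4-cycle on its
-- vertices, so the vertices are two pairs of opposite points of the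
-- quadrilateral ℓ₁, ℓ₋₁, ℓ′, ℓ″, and two of its three diagonals meet in the
-- unital.  The diagonals are x = 0, y = - x₁ and y = - x₂.  The last two meet
-- in (1,0,0), off the unital; the first meets y = - xᵢ in (0,- xᵢ,1), which is
-- in the unital only if xᵢ lies in 𝔽q.  But then a ^ q - b lies in 𝔽q, and the
-- discriminant is the square of the element a + a ^ q of 𝔽q.

module Submission where

open import Defs
open import Algebra.Bundles using (CommutativeMonoid; CommutativeRing; CommutativeSemiring)
import Algebra.Properties.AbelianGroup
import Algebra.Properties.CommutativeMonoid.Sum
import Algebra.Properties.CommutativeSemiring.Binomial
import Algebra.Properties.CommutativeSemiring.Exp
import Algebra.Properties.Ring
import Algebra.Properties.Semiring.Mult
import Algebra.Properties.Semiring.Mult.TCOptimised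
import Algebra.Solver.Ring
import Algebra.Solver.Ring.AlmostCommutativeRing as ACR
open import Data.Fin.Base using (Fin; zero; suc; toℕ; fromℕ; inject₁; punchIn; opposite)
open import Data.Fin.Patterns using (0F; 1F; 2F; 3F)
open import Data.Fin.Permutation using (Permutation; permutation)
import Data.Fin.Properties as Fin
open import Data.Fin.Properties using (all?; any?; toℕ<n; toℕ-inject₁; toℕ-fromℕ; punchInᵢ≢i)
open import Data.Integer.Base as ℤ using (ℤ; +_; -[1+_]; _⊖_; _◃_)
import Data.Integer.Properties as ℤ
open import Data.Maybe.Base using (Maybe; map)
open import Data.Nat.Base as ℕ using (ℕ; zero; suc; _<_; _∸_; _!; s≤s)
open import Data.Nat.Combinatorics
  using (nCn≡1; nCk≡n!/k![n-k]!; k![n∸k]!∣n!) renaming (_C_ to _choose_)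
open import Data.Nat.Divisibility using (_∣_; _∤_; ∣⇒≤; m∣m*n; divides)
open import Data.Nat.DivMod using (m/n*n≡m)
open import Data.Nat.Primality using (Prime; euclidsLemma; prime⇒nonTrivial; prime⇒nonZero)
import Data.Nat.Properties as ℕ
open import Data.Product.Base using (∃-syntax; _×_; _,_; proj₁; proj₂)
import Data.Sign.Base as Sign
open import Data.Sum.Base using (_⊎_; inj₁; inj₂; [_,_]′)
open import Data.Vec.Functional using (Vector; []; _∷_; removeAt; replicate)
open import Function.Base using (_∘_)
open import Function.Bundles using (Inverse)
open import Level using (_⊔_)
open import Relation.Binary.Consequences using (dec⇒weaklyDec)
open import Relation.Binary.PropositionalEquality as ≡ using (_≡_; _≢_)
import Relation.Binary.Reasoning.Setoid
open import Relation.Nullary.Decidable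
  using (Dec; yes; no; from-yes; _×-dec_; _⊎-dec_; _→-dec_; ¬?)
open import Relation.Nullary.Negation using (¬_; contradiction)
open import Relation.Unary using (Pred; _∈_)

-- Divisibility of binomial coefficients by a prime.

prime∤! : ∀ {p} → Prime p → ∀ n → n < p → p ∤ n !
prime∤! pr zero    _   p∣1 = ℕ.<⇒≱ (ℕ.nonTrivial⇒n>1 _ {{prime⇒nonTrivial pr}}) (∣⇒≤ p∣1)
prime∤! pr (suc n) n<p p∣n! with euclidsLemma (suc n) (n !) pr p∣n!
... | inj₁ p∣1+n = ℕ.<⇒≱ n<p (∣⇒≤ p∣1+n)
... | inj₂ p∣n!′ = prime∤! pr n (ℕ.<-trans (ℕ.n<1+n n) n<p) p∣n!′

-- The coefficient times two factorials is `suc n !`. Both factorials are of numbers below the prime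
-- `suc n`, so Euclid's lemma leaves the coefficient.
prime∣choose : ∀ {n} → Prime (suc n) → ∀ k → suc k < suc n → suc n ∣ suc n choose suc k
prime∣choose {n} pr k k<n
  with euclidsLemma (suc n choose suc k) (suc k ! ℕ.* (n ∸ k) !) pr
         (≡.subst (suc n ∣_) (≡.sym choose*k!*[n-k]!≡n!) (m∣m*n (n !)))
  where
  instance _ = ℕ._!*_!≢0 (suc k) (n ∸ k)
  k≤n = ℕ.<⇒≤ k<n
  choose*k!*[n-k]!≡n! : (suc n choose suc k) ℕ.* (suc k ! ℕ.* (n ∸ k) !) ≡ suc n !
  choose*k!*[n-k]!≡n! = ≡.trans
    (≡.cong (ℕ._* (suc k ! ℕ.* (n ∸ k) !)) (nCk≡n!/k![n-k]! k≤n))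
    (m/n*n≡m (k![n∸k]!∣n! k≤n))
... | inj₁ p∣choose = p∣choose
... | inj₂ p∣k!*[n-k]! with euclidsLemma (suc k !) ((n ∸ k) !) pr p∣k!*[n-k]!
...   | inj₁ p∣k!     = contradiction p∣k! (prime∤! pr (suc k) k<n)
...   | inj₂ p∣[n-k]! = contradiction p∣[n-k]! (prime∤! pr (n ∸ k) (s≤s (ℕ.m∸n≤m n k)))

-- Additivity of the Frobenius map and its powers.

module FreshmansDream {c ℓ} (R : CommutativeSemiring c ℓ) where
  open CommutativeSemiring R hiding (zero)
  open Algebra.Properties.CommutativeSemiring.Binomial R
  open Algebra.Properties.CommutativeSemiring.Exp R
  open Algebra.Properties.Semiring.Mult semiring renaming (_×_ to _·_)
  open Algebra.Properties.CommutativeMonoid.Sum +-commutativeMonoid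
  open Relation.Binary.Reasoning.Setoid setoid

  ∣⇒·≈0 : ∀ {m n} → m · 1# ≈ 0# → m ∣ n → ∀ x → n · x ≈ 0#
  ∣⇒·≈0 {m} m·1≈0 (divides k ≡.refl) x = begin
    (k ℕ.* m) · x        ≈⟨ ×-assocˡ x k m ⟨
    k · (m · x)          ≈⟨ ×-congʳ k (×-congʳ m (*-identityˡ x)) ⟨
    k · (m · (1# * x))   ≈⟨ ×-congʳ k (×-assoc-* m 1# x) ⟨
    k · (m · 1# * x)     ≈⟨ ×-congʳ k (trans (*-congʳ m·1≈0) (zeroˡ x)) ⟩
    k · 0#               ≈⟨ sum-replicate k ⟨
    sum (replicate k 0#) ≈⟨ sum-replicate-zero k ⟩
    0#                   ∎

  -- Every inner term of the binomial expansion has a coefficient divisible by `p` and vanishes, so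
  -- only the two outer terms survive.
  ^p-distrib-+ : ∀ {p} → Prime p → p · 1# ≈ 0# → ∀ x y → (x + y) ^ p ≈ x ^ p + y ^ p
  ^p-distrib-+ {suc n} pr p·1≈0 x y = begin
    (x + y) ^ suc n
      ≈⟨ theorem (suc n) x y ⟩
    t zero + sum (t ∘ suc)
      ≈⟨ +-congˡ (sum-init-last (t ∘ suc)) ⟩
    t zero + (sum (t ∘ suc ∘ inject₁) + t (suc (fromℕ n)))
      ≈⟨ +-cong t₀ (+-cong middle tₙ) ⟩
    y ^ suc n + (0# + x ^ suc n)
      ≈⟨ trans (+-congˡ (+-identityˡ _)) (+-comm _ _) ⟩
    x ^ suc n + y ^ suc n ∎
    where
    t = binomialTerm x y (suc n)
    t₀ : t zero ≈ y ^ suc n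
    t₀ = trans (+-identityʳ _) (*-identityˡ _)
    tₙ : t (suc (fromℕ n)) ≈ x ^ suc n
    tₙ rewrite toℕ-fromℕ n | nCn≡1 (suc n) | ℕ.n∸n≡0 n = trans (+-identityʳ _) (*-identityʳ _)
    middle : sum (t ∘ suc ∘ inject₁) ≈ 0#
    middle = trans
      (sum-cong-≋ λ i → ∣⇒·≈0 p·1≈0
        (prime∣choose pr (toℕ (inject₁ i))
          (≡.subst (ℕ._< suc n) (≡.cong suc (≡.sym (toℕ-inject₁ i))) (s≤s (toℕ<n i))))
        (binomial x y (suc n) (suc (inject₁ i))))
      (sum-replicate-zero n)

  ^pᵏ-distrib-+ : ∀ {p} → Prime p → p · 1# ≈ 0# →
                  ∀ k x y → (x + y) ^ (p ℕ.^ k) ≈ x ^ (p ℕ.^ k) + y ^ (p ℕ.^ k)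
  ^pᵏ-distrib-+ pr p·1≈0 zero x y =
    trans (*-identityʳ _) (sym (+-cong (*-identityʳ x) (*-identityʳ y)))
  ^pᵏ-distrib-+ {p} pr p·1≈0 (suc k) x y = begin
    (x + y) ^ (p ℕ.* m)           ≈⟨ ^-assocʳ (x + y) p m ⟨
    ((x + y) ^ p) ^ m             ≈⟨ ^-congˡ m (^p-distrib-+ pr p·1≈0 x y) ⟩
    (x ^ p + y ^ p) ^ m           ≈⟨ ^pᵏ-distrib-+ pr p·1≈0 k (x ^ p) (y ^ p) ⟩
    (x ^ p) ^ m + (y ^ p) ^ m     ≈⟨ +-cong (^-assocʳ x p m) (^-assocʳ y p m) ⟩
    x ^ (p ℕ.* m) + y ^ (p ℕ.* m) ∎
    where m = p ℕ.^ k

-- Ring solver with integer coefficients.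

-- Integer coefficients let the solver cancel subtracted terms over an
-- abstract ring.
module IntegerSolver {c ℓ} (R : CommutativeRing c ℓ) where
  open CommutativeRing R hiding (zero)
  open Algebra.Properties.Semiring.Mult.TCOptimised semiring renaming (_×_ to _·_)
  open Algebra.Properties.Ring ring
  open Algebra.Properties.AbelianGroup +-abelianGroup using (⁻¹-∙-comm)
  open Relation.Binary.Reasoning.Setoid setoid

  fromℤ : ℤ → Carrier
  fromℤ (+ n)    = n · 1#
  fromℤ -[1+ n ] = - (suc n · 1#)

  ⊖-homo : ∀ m n → fromℤ (m ⊖ n) ≈ m · 1# - n · 1#
  ⊖-homo zero    zero    = sym (-‿inverseʳ 0#)
  ⊖-homo zero    (suc n) = sym (+-identityˡ _)
  ⊖-homo (suc m) zero    = sym (trans (+-congˡ -0#≈0#) (+-identityʳ _))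
  ⊖-homo (suc m) (suc n) = begin
    fromℤ (suc m ⊖ suc n)       ≡⟨ ≡.cong fromℤ (ℤ.[1+m]⊖[1+n]≡m⊖n m n) ⟩
    fromℤ (m ⊖ n)               ≈⟨ ⊖-homo m n ⟩
    u - v                       ≈⟨ +-congʳ (trans (+-congʳ (-‿inverseʳ 1#)) (+-identityˡ u)) ⟨
    (1# - 1# + u) - v           ≈⟨ +-congʳ (trans (+-assoc _ _ _)
                                     (trans (+-congˡ (+-comm _ _)) (sym (+-assoc _ _ _)))) ⟩
    (1# + u - 1#) - v           ≈⟨ trans (+-assoc _ _ _) (+-congˡ (⁻¹-∙-comm 1# v)) ⟩
    (1# + u) - (1# + v)         ≈⟨ +-cong (1+× m 1#) (-‿cong (1+× n 1#)) ⟨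
    suc m · 1# - suc n · 1#     ∎
    where u = m · 1#; v = n · 1#

  +◃-homo : ∀ n → fromℤ (Sign.+ ◃ n) ≈ n · 1#
  +◃-homo zero    = refl
  +◃-homo (suc n) = refl

  -◃-homo : ∀ n → fromℤ (Sign.- ◃ n) ≈ - (n · 1#)
  -◃-homo zero    = sym -0#≈0#
  -◃-homo (suc n) = refl

  +-homo : ∀ i j → fromℤ (i ℤ.+ j) ≈ fromℤ i + fromℤ j
  +-homo (+ m)    (+ n)    = ×-homo-+ 1# m n
  +-homo (+ m)    -[1+ n ] = ⊖-homo m (suc n)
  +-homo -[1+ m ] (+ n)    = trans (⊖-homo n (suc m)) (+-comm _ _)
  +-homo -[1+ m ] -[1+ n ] = begin
    - (suc (suc (m ℕ.+ n)) · 1#)        ≡⟨ ≡.cong (λ k → - (suc k · 1#)) (≡.sym (ℕ.+-suc m n)) ⟩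
    - ((suc m ℕ.+ suc n) · 1#)          ≈⟨ -‿cong (×-homo-+ 1# (suc m) (suc n)) ⟩
    - (suc m · 1# + suc n · 1#)         ≈⟨ ⁻¹-∙-comm _ _ ⟨
    - (suc m · 1#) - suc n · 1#         ∎

  *-homo : ∀ i j → fromℤ (i ℤ.* j) ≈ fromℤ i * fromℤ j
  *-homo (+ m)    (+ n)    = trans (+◃-homo (m ℕ.* n)) (×1-homo-* m n)
  *-homo (+ m)    -[1+ n ] = trans (-◃-homo (m ℕ.* suc n))
    (trans (-‿cong (×1-homo-* m (suc n))) (-‿distribʳ-* _ _))
  *-homo -[1+ m ] (+ n)    = trans (-◃-homo (suc m ℕ.* n))
    (trans (-‿cong (×1-homo-* (suc m) n)) (-‿distribˡ-* _ _))
  *-homo -[1+ m ] -[1+ n ] = trans (×1-homo-* (suc m) (suc n))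
    (sym (trans (sym (-‿distribˡ-* _ _)) (trans (-‿cong (sym (-‿distribʳ-* _ _))) (-‿involutive _))))

  -‿homo : ∀ i → fromℤ (ℤ.- i) ≈ - fromℤ i
  -‿homo (+ zero)  = sym -0#≈0#
  -‿homo (+ suc n) = refl
  -‿homo -[1+ n ]  = sym (-‿involutive _)

  morphism : ℤ.+-*-rawRing ACR.-Raw-AlmostCommutative⟶ ACR.fromCommutativeRing R
  morphism = record
    { ⟦_⟧    = fromℤ
    ; +-homo = +-homo
    ; *-homo = *-homo
    ; -‿homo = -‿homo
    ; 0-homo = refl
    ; 1-homo = refl
    }

  coefficient-equality : ∀ i j → Maybe (fromℤ i ≈ fromℤ j)
  coefficient-equality i j = map (reflexive ∘ ≡.cong fromℤ) (dec⇒weaklyDec ℤ._≟_ i j)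

  open Algebra.Solver.Ring ℤ.+-*-rawRing (ACR.fromCommutativeRing R) morphism
    coefficient-equality public using (Polynomial; solve; _:=_; _:+_; _:*_; _:-_; :-_; con)

  :0 :1 : ∀ {n} → Polynomial n
  :0 = con (+ 0)
  :1 = con (+ 1)

-- Cancellation and inverses in a field.

module FieldProperties {c ℓ n} (K : FiniteField c ℓ n) where
  open FieldOperations K hiding (zero)
  open Relation.Binary.Reasoning.Setoid ≈-setoid

  ⁻¹-inverseˡ : ∀ x → x ≉ 0# → x ⁻¹ * x ≈ 1#
  ⁻¹-inverseˡ x x≉0 = trans (*-comm _ _) (⁻¹-inverseʳ x x≉0)

  *-cancelˡ : ∀ {x y z} → x ≉ 0# → x * y ≈ x * z → y ≈ z
  *-cancelˡ {x} {y} {z} x≉0 xy≈xz = begin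
    y              ≈⟨ cancel y ⟨
    x ⁻¹ * (x * y) ≈⟨ *-congˡ xy≈xz ⟩
    x ⁻¹ * (x * z) ≈⟨ cancel z ⟩
    z              ∎
    where
    cancel : ∀ w → x ⁻¹ * (x * w) ≈ w
    cancel w = trans (sym (*-assoc _ _ _)) (trans (*-congʳ (⁻¹-inverseˡ x x≉0)) (*-identityˡ w))

  *≈0⇒≈0ʳ : ∀ {x y} → x ≉ 0# → x * y ≈ 0# → y ≈ 0#
  *≈0⇒≈0ʳ x≉0 xy≈0 = *-cancelˡ x≉0 (trans xy≈0 (sym (zeroʳ _)))

  *-≉0 : ∀ {x y} → x ≉ 0# → y ≉ 0# → x * y ≉ 0#
  *-≉0 x≉0 y≉0 xy≈0 = y≉0 (*≈0⇒≈0ʳ x≉0 xy≈0)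

  0^ : ∀ m → .{{ℕ.NonZero m}} → 0# ^ m ≈ 0#
  0^ (suc m) = zeroˡ _

  ^≈0⇒≈0 : ∀ {x} m → x ^ m ≈ 0# → x ≈ 0#
  ^≈0⇒≈0     zero    1≈0    = contradiction 1≈0 1≉0
  ^≈0⇒≈0 {x} (suc m) x*xᵐ≈0 with x ≟ 0#
  ... | yes x≈0 = x≈0
  ... | no  x≉0 = ^≈0⇒≈0 m (*≈0⇒≈0ʳ x≉0 x*xᵐ≈0)

  -- A quotient with zero denominator is therefore zero. This is how a nonzero `x[ λ₀ ]` yields a
  -- nonzero denominator.
  ⁻¹-0 : ∀ {x} → x ≈ 0# → x ⁻¹ ≈ 0#
  ⁻¹-0 {x} x≈0 with x ≟ 0#
  ... | yes _   = refl
  ... | no  x≉0 = contradiction x≈0 x≉0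

-- Sums and products over all elements of a finite field.

module FiniteFieldProperties {c ℓ n} (K : FiniteField c ℓ n) where
  open FieldOperations K hiding (zero)
  open FieldProperties K
  open Algebra.Properties.Semiring.Mult semiring using (×1-homo-*)
  open Algebra.Properties.Ring ring using (+-cancelˡ)
  open Inverse enumeration

  from-to : ∀ x → from (to x) ≈ x
  from-to x = inverseʳ ≡.refl

  -- Conjugation by the enumeration carries a bijection of the field to a permutation of indices, to
  -- which reindexing of finite sums applies.
  permute : (f g : Carrier → Carrier) →
            (∀ {x y} → x ≈ y → f x ≈ f y) → (∀ {x y} → x ≈ y → g x ≈ g y) →
            (∀ x → f (g x) ≈ x) → (∀ x → g (f x) ≈ x) → Permutation n n
  permute f g f-cong g-cong fg gf = permutation (conj f) (conj g)
    (inv f g f-cong fg) (inv g f g-cong gf)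
    where
    conj : (Carrier → Carrier) → Fin n → Fin n
    conj h i = to (h (from i))
    inv : ∀ h k → (∀ {x y} → x ≈ y → h x ≈ h y) → (∀ x → h (k x) ≈ x) →
          ∀ i → conj h (conj k i) ≡ i
    inv h k h-cong hk i = inverseˡ (trans (h-cong (from-to _)) (hk (from i)))

  -- Stated for any commutative monoid, to serve both the sum and the product over the field.
  module Reindex {c′ ℓ′} (M : CommutativeMonoid c′ ℓ′) where
    private module M = CommutativeMonoid M
    open Algebra.Properties.CommutativeMonoid.Sum M

    total : (Carrier → M.Carrier) → M.Carrier
    total h = sum (h ∘ from)

    total-cong : ∀ {h k} → (∀ x → h x M.≈ k x) → total h M.≈ total k
    total-cong h≈k = sum-cong-≋ (h≈k ∘ from)

    total-reindex : ∀ {h} → (∀ {x y} → x ≈ y → h x M.≈ h y) → (f g : Carrier → Carrier) →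
                    (∀ {x y} → x ≈ y → f x ≈ f y) → (∀ {x y} → x ≈ y → g x ≈ g y) →
                    (∀ x → f (g x) ≈ x) → (∀ x → g (f x) ≈ x) →
                    total (h ∘ f) M.≈ total h
    total-reindex h-cong f g f-cong g-cong fg gf =
      M.sym (M.trans (sum-permute {n} _ (permute f g f-cong g-cong fg gf))
                     (sum-cong-≋ λ i → h-cong (from-to (f (from i)))))

  module Σ where
    open Algebra.Properties.CommutativeMonoid.Sum +-commutativeMonoid public
    open Reindex +-commutativeMonoid public

  module Π where
    open Algebra.Properties.CommutativeMonoid.Sum *-commutativeMonoid public
      renaming (sum to product; ∑-distrib-+ to ∏-distrib-*; sum-remove to product-remove;
                sum-replicate to product-replicate; sum-cong-≋ to product-cong-≋)
    open Reindex *-commutativeMonoid public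

  open Relation.Binary.Reasoning.Setoid ≈-setoid

  -- Translation by 1 permutes K, so Σ x = Σ (x + 1) = Σ x + n · 1.
  order·1≈0 : n · 1# ≈ 0#
  order·1≈0 = +-cancelˡ S _ _ (begin
    S + n · 1#             ≈⟨ +-congˡ (Σ.sum-replicate n) ⟨
    S + Σ.total (λ _ → 1#) ≈⟨ Σ.∑-distrib-+ from (λ _ → 1#) ⟨
    Σ.total (_+ 1#)        ≈⟨ Σ.total-reindex (λ e → e) (_+ 1#) (_- 1#) +-congʳ +-congʳ
                                (λ x → cancel x (-‿inverseˡ 1#)) (λ x → cancel x (-‿inverseʳ 1#)) ⟩
    S                      ≈⟨ +-identityʳ S ⟨
    S + 0#                 ∎)
    where
    S = Σ.total (λ x → x)
    cancel : ∀ x {y z} → y + z ≈ 0# → x + y + z ≈ x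
    cancel x y+z≈0 = trans (+-assoc _ _ _) (trans (+-congˡ y+z≈0) (+-identityʳ x))

  -- The map sending `m` to `m · 1#` is multiplicative, and a field has no nonzero nilpotents.
  -- Applied twice, this passes from the order of the field down to its characteristic.
  ^·1≈0⇒·1≈0 : ∀ m k → (m ℕ.^ k) · 1# ≈ 0# → m · 1# ≈ 0#
  ^·1≈0⇒·1≈0 m k e = ^≈0⇒≈0 k (trans (homo k) e)
    where
    homo : ∀ k → (m · 1#) ^ k ≈ (m ℕ.^ k) · 1#
    homo zero    = sym (+-identityʳ 1#)
    homo (suc k) = trans (*-congˡ (homo k)) (sym (×1-homo-* m (m ℕ.^ k)))

  product-≉0 : ∀ {m} (v : Vector Carrier m) → (∀ i → v i ≉ 0#) → Π.product v ≉ 0#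
  product-≉0 {zero}  v v≉0 = 1≉0
  product-≉0 {suc m} v v≉0 = *-≉0 (v≉0 zero) (product-≉0 (v ∘ suc) (v≉0 ∘ suc))

  -- The value 1 at zero is neutral in a product, so a product over the whole field becomes one over
  -- the nonzero elements.
  if≈0_then1else_ : Carrier → Carrier → Carrier
  if≈0 x then1else y with x ≟ 0#
  ... | yes _ = 1#
  ... | no  _ = y

  if-yes : ∀ {x} y → x ≈ 0# → if≈0 x then1else y ≈ 1#
  if-yes {x} y x≈0 with x ≟ 0#
  ... | yes _   = refl
  ... | no  x≉0 = contradiction x≈0 x≉0

  if-no : ∀ {x} y → x ≉ 0# → if≈0 x then1else y ≈ y
  if-no {x} y x≉0 with x ≟ 0#
  ... | yes x≈0 = contradiction x≈0 x≉0
  ... | no  _   = refl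

  unit : Carrier → Carrier
  unit x = if≈0 x then1else x

  unit-cong : ∀ {x y} → x ≈ y → unit x ≈ unit y
  unit-cong {x} {y} x≈y with x ≟ 0#
  ... | yes x≈0 = sym (if-yes y (trans (sym x≈y) x≈0))
  ... | no  x≉0 = trans x≈y (sym (if-no y (x≉0 ∘ trans x≈y)))

  unit≉0 : ∀ x → unit x ≉ 0#
  unit≉0 x with x ≟ 0#
  ... | yes _   = 1≉0
  ... | no  x≉0 = x≉0

  unit-* : ∀ {a} → a ≉ 0# → ∀ x → unit (a * x) ≈ if≈0 x then1else a * unit x
  unit-* {a} a≉0 x with x ≟ 0#
  ... | yes x≈0 = trans (if-yes _ (trans (*-congˡ x≈0) (zeroʳ a))) (sym (*-identityˡ 1#))
  ... | no  x≉0 = if-no _ (*-≉0 a≉0 x≉0)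

  -- The product contributes one `a` for each of the `n - 1` nonzero elements; the outer factor
  -- fills the place of `0#`.
  product-if : ∀ a → a * Π.total (λ x → if≈0 x then1else a) ≈ a ^ n
  product-if a = go n ≡.refl
    where
    -- Splitting a copy `m` of `n` exposes the successor from which the factor at `0#` is removed.
    -- The case `zero` is impossible because `to 0#` would inhabit an empty type.
    go : ∀ m → m ≡ n → a * Π.total (λ x → if≈0 x then1else a) ≈ a ^ n
    go zero    ≡.refl with () ← to 0#
    go (suc m) ≡.refl = *-congˡ (begin
      Π.product v
        ≈⟨ Π.product-remove {i = to 0#} v ⟩
      v (to 0#) * Π.product (removeAt v (to 0#))
        ≈⟨ *-cong (if-yes a (from-to 0#)) (Π.product-cong-≋ λ i → if-no a (from≉0 i)) ⟩
      1# * Π.product (replicate m a)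
        ≈⟨ trans (*-identityˡ _) (Π.product-replicate m) ⟩
      a ^ m ∎)
      where
      v = λ i → if≈0 from i then1else a
      from≉0 : ∀ i → from (punchIn (to 0#) i) ≉ 0#
      from≉0 i e = punchInᵢ≢i (to 0#) i (≡.sym (inverseˡ (sym e)))

  -- Multiplication by a permutes the nonzero elements, whose product is Π unit.
  ^order : ∀ a → a ^ n ≈ a
  ^order a with a ≟ 0#
  ... | yes a≈0 = go n ≡.refl
    where
    go : ∀ m → m ≡ n → a ^ n ≈ a
    go zero    ≡.refl with () ← to 0#
    go (suc m) ≡.refl = trans (trans (*-congʳ a≈0) (zeroˡ _)) (sym a≈0)
  ... | no a≉0 = begin
    a ^ n  ≈⟨ product-if a ⟨
    a * C  ≈⟨ *-congˡ C≈1 ⟩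
    a * 1# ≈⟨ *-identityʳ a ⟩
    a      ∎
    where
    C = Π.total (λ x → if≈0 x then1else a)
    U = Π.total unit
    inv : ∀ {x y} → x * y ≈ 1# → ∀ z → x * (y * z) ≈ z
    inv xy≈1 z = trans (sym (*-assoc _ _ _)) (trans (*-congʳ xy≈1) (*-identityˡ z))
    C≈1 : C ≈ 1#
    C≈1 = *-cancelˡ (product-≉0 (unit ∘ from) (unit≉0 ∘ from)) (begin
      U * C
        ≈⟨ *-comm U C ⟩
      C * U
        ≈⟨ Π.∏-distrib-* (λ i → if≈0 from i then1else a) (unit ∘ from) ⟨
      Π.total (λ x → if≈0 x then1else a * unit x)
        ≈⟨ Π.total-cong (unit-* a≉0) ⟨
      Π.total (unit ∘ (a *_))
        ≈⟨ Π.total-reindex unit-cong (a *_) (a ⁻¹ *_) *-congˡ *-congˡ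
             (inv (⁻¹-inverseʳ a a≉0)) (inv (⁻¹-inverseˡ a a≉0)) ⟩
      U
        ≈⟨ *-identityʳ U ⟨
      U * 1# ∎)

-- The complete graph on four vertices.

module K₄ where

  Vertex Edge : Set
  Vertex = Fin 4
  Edge   = Fin 6

  -- In this order the edge disjoint from e is opposite e.
  source target : Edge → Vertex
  source = 0F ∷ 0F ∷ 0F ∷ 1F ∷ 1F ∷ 2F ∷ []
  target = 1F ∷ 2F ∷ 3F ∷ 2F ∷ 3F ∷ 3F ∷ []

  infix 4 _∋_ _∋?_

  _∋_ : Edge → Vertex → Set
  e ∋ v = source e ≡ v ⊎ target e ≡ v

  _∋?_ : ∀ e v → Dec (e ∋ v)
  e ∋? v = (source e Fin.≟ v) ⊎-dec (target e Fin.≟ v)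

  Joins : Edge → Vertex → Vertex → Set
  Joins e i j = (source e ≡ i × target e ≡ j) ⊎ (source e ≡ j × target e ≡ i)

  joining : ∀ i j → i ≢ j → ∃[ e ] Joins e i j
  joining = from-yes (all? λ i → all? λ j → ¬? (i Fin.≟ j) →-dec any? λ e →
    ((source e Fin.≟ i) ×-dec (target e Fin.≟ j)) ⊎-dec
    ((source e Fin.≟ j) ×-dec (target e Fin.≟ i)))

  Concurrentₑ : Edge → Edge → Edge → Set
  Concurrentₑ e f g = ∃[ v ] (e ∋ v × f ∋ v × g ∋ v)

  concurrentₑ? : ∀ e f g → Dec (Concurrentₑ e f g)
  concurrentₑ? e f g = any? λ v → (e ∋? v) ×-dec (f ∋? v) ×-dec (g ∋? v)

  -- Four of the six edges omit two. If the omitted edges shared a vertex, the vertex on neither of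
  -- them would keep all three of its edges, which are then concurrent. So the omitted edges are
  -- opposite, and the remaining four form two opposite pairs. The proof checks all quadruples of
  -- edges.
  two-matchings : ∀ e f g h →
    e ≢ f → e ≢ g → e ≢ h → f ≢ g → f ≢ h → g ≢ h →
    ¬ Concurrentₑ e f g → ¬ Concurrentₑ e f h → ¬ Concurrentₑ e g h → ¬ Concurrentₑ f g h →
    (f ≡ opposite e × h ≡ opposite g) ⊎
    (g ≡ opposite e × h ≡ opposite f) ⊎
    (h ≡ opposite e × g ≡ opposite f)
  two-matchings = from-yes (all? λ e → all? λ f → all? λ g → all? λ h →
    e ≢? f →-dec e ≢? g →-dec e ≢? h →-dec f ≢? g →-dec f ≢? h →-dec g ≢? h →-dec
    ¬? (concurrentₑ? e f g) →-dec ¬? (concurrentₑ? e f h) →-dec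
    ¬? (concurrentₑ? e g h) →-dec ¬? (concurrentₑ? f g h) →-dec
    (((f Fin.≟ opposite e) ×-dec (h Fin.≟ opposite g)) ⊎-dec
     ((g Fin.≟ opposite e) ×-dec (h Fin.≟ opposite f)) ⊎-dec
     ((h Fin.≟ opposite e) ×-dec (g Fin.≟ opposite f))))
    where
    infix 5 _≢?_
    _≢?_ : (e f : Edge) → Dec (e ≢ f)
    e ≢? f = ¬? (e Fin.≟ f)

  opposite-disjoint : ∀ e v → e ∋ v → ¬ opposite e ∋ v
  opposite-disjoint = from-yes (all? λ e → all? λ v → (e ∋? v) →-dec ¬? (opposite e ∋? v))

  Meet : Edge → Edge → Set
  Meet e f = ∃[ v ] (e ∋ v × f ∋ v)

  meet? : ∀ e f → Dec (Meet e f)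
  meet? e f = any? λ v → (e ∋? v) ×-dec (f ∋? v)

  -- Distinct edges that are not opposite share a vertex. Two opposite pairs thus form a 4-cycle,
  -- whose corners are listed in cyclic order.
  corners : ∀ e f → e ≢ f → f ≢ opposite e →
            Meet e f × Meet f (opposite e) × Meet (opposite e) (opposite f) × Meet (opposite f) e
  corners = from-yes (all? λ e → all? λ f → ¬? (e Fin.≟ f) →-dec ¬? (f Fin.≟ opposite e) →-dec
    meet? e f ×-dec meet? f (opposite e) ×-dec
    meet? (opposite e) (opposite f) ×-dec meet? (opposite f) e)

-- Joins and meets in the projective plane.

module ProjectiveProperties {f ℓ n} (K : FiniteField f ℓ n) where
  open FieldOperations K hiding (zero)
  open ProjectivePlane K
  open FieldProperties K
  open IntegerSolver commutativeRing
  open Relation.Binary.Reasoning.Setoid ≈-setoid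

  -- Points and lines are both treated as coordinate triples, so that `⊥-unique` gives uniqueness of
  -- the line through two points and, dually, of the point on two lines.
  Triple : Set f
  Triple = Carrier × Carrier × Carrier

  Zero : Triple → Set ℓ
  Zero (x , y , z) = x ≈ 0# × y ≈ 0# × z ≈ 0#

  zero? : ∀ u → Dec (Zero u)
  zero? (x , y , z) = (x ≟ 0#) ×-dec (y ≟ 0#) ×-dec (z ≟ 0#)

  infixl 7 _⨯_
  infix 4 _∥_ _⊥_

  _∥_ : Triple → Triple → Set (f ⊔ ℓ)
  (x , y , z) ∥ (x′ , y′ , z′) = ∃[ k ] (k ≉ 0# × x ≈ k * x′ × y ≈ k * y′ × z ≈ k * z′)

  _⊥_ : Triple → Triple → Set ℓ
  (l , m , n) ⊥ (x , y , z) = l * x + m * y + n * z ≈ 0#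

  _⨯_ : Triple → Triple → Triple
  (x , y , z) ⨯ (x′ , y′ , z′) = y * z′ - z * y′ , z * x′ - x * z′ , x * y′ - y * x′

  ∥-sym : ∀ {u v} → u ∥ v → v ∥ u
  ∥-sym (k , k≉0 , e₁ , e₂ , e₃) = k ⁻¹ , k⁻¹≉0 , flip e₁ , flip e₂ , flip e₃
    where
    k⁻¹≉0 : k ⁻¹ ≉ 0#
    k⁻¹≉0 e = 1≉0 (trans (sym (⁻¹-inverseʳ k k≉0)) (trans (*-congˡ e) (zeroʳ k)))
    flip : ∀ {x x′} → x ≈ k * x′ → x′ ≈ k ⁻¹ * x
    flip {x} {x′} x≈kx′ = sym (begin
      k ⁻¹ * x        ≈⟨ *-congˡ x≈kx′ ⟩
      k ⁻¹ * (k * x′) ≈⟨ *-assoc _ _ _ ⟨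
      k ⁻¹ * k * x′   ≈⟨ *-congʳ (⁻¹-inverseˡ k k≉0) ⟩
      1# * x′         ≈⟨ *-identityˡ x′ ⟩
      x′              ∎)

  ∥-trans : ∀ {u v w} → u ∥ v → v ∥ w → u ∥ w
  ∥-trans (k , k≉0 , e₁ , e₂ , e₃) (k′ , k′≉0 , e₁′ , e₂′ , e₃′) =
    k * k′ , *-≉0 k≉0 k′≉0 , comp e₁ e₁′ , comp e₂ e₂′ , comp e₃ e₃′
    where
    comp : ∀ {x y z} → x ≈ k * y → y ≈ k′ * z → x ≈ k * k′ * z
    comp x≈ky y≈k′z = trans x≈ky (trans (*-congˡ y≈k′z) (sym (*-assoc _ _ _)))

  -- Some coordinate of `v` is nonzero. The ratio of the corresponding coordinates of `u` and `v` is
  -- the factor of proportionality, and it is nonzero because `u` is.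
  ⨯≈0⇒∥ : ∀ {u v} → ¬ Zero u → ¬ Zero v → Zero (u ⨯ v) → u ∥ v
  ⨯≈0⇒∥ {u@(x , y , z)} {v@(x′ , y′ , z′)} u≉0 v≉0 (yz-zy≈0 , zx-xz≈0 , xy-yx≈0) = by-pivot
    where
    open Algebra.Properties.AbelianGroup +-abelianGroup using (x∙y⁻¹≈ε⇒x≈y)
    yz = x∙y⁻¹≈ε⇒x≈y _ _ yz-zy≈0
    zx = x∙y⁻¹≈ε⇒x≈y _ _ zx-xz≈0
    xy = x∙y⁻¹≈ε⇒x≈y _ _ xy-yx≈0
    scale : ∀ {p p′} → p′ ≉ 0# → ∀ w w′ → w * p′ ≈ p * w′ → w ≈ p / p′ * w′
    scale {p} {p′} p′≉0 w w′ e = *-cancelˡ p′≉0 (begin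
      p′ * w                ≈⟨ trans (*-comm _ _) e ⟩
      p * w′                ≈⟨ *-identityˡ _ ⟨
      1# * (p * w′)         ≈⟨ *-congʳ (⁻¹-inverseʳ p′ p′≉0) ⟨
      p′ * p′ ⁻¹ * (p * w′) ≈⟨ solve 4 (λ a b c d → a :* b :* (c :* d) := a :* (c :* b :* d))
                                 refl p′ (p′ ⁻¹) p w′ ⟩
      p′ * (p / p′ * w′)    ∎)
    pivot : ∀ {p p′} → p′ ≉ 0# → x * p′ ≈ p * x′ → y * p′ ≈ p * y′ → z * p′ ≈ p * z′ → u ∥ v
    pivot {p} {p′} p′≉0 e₁ e₂ e₃ = p / p′ , k≉0 , x≈ , y≈ , z≈
      where
      x≈ = scale p′≉0 x x′ e₁
      y≈ = scale p′≉0 y y′ e₂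
      z≈ = scale p′≉0 z z′ e₃
      k≉0 : p / p′ ≉ 0#
      k≉0 k≈0 = u≉0 (vanish x≈ , vanish y≈ , vanish z≈)
        where
        vanish : ∀ {w w′} → w ≈ p / p′ * w′ → w ≈ 0#
        vanish e = trans e (trans (*-congʳ k≈0) (zeroˡ _))
    by-pivot : u ∥ v
    by-pivot with x′ ≟ 0# | y′ ≟ 0# | z′ ≟ 0#
    ... | no x′≉0  | _        | _        = pivot x′≉0 refl (sym xy) zx
    ... | yes _    | no y′≉0  | _        = pivot y′≉0 xy refl (sym yz)
    ... | yes _    | yes _    | no z′≉0  = pivot z′≉0 (sym zx) yz refl
    ... | yes x′≈0 | yes y′≈0 | yes z′≈0 = contradiction (x′≈0 , y′≈0 , z′≈0) v≉0

  -- By the triple product expansion, w ⨯ (u ⨯ v) = (w·v) u - (w·u) v, which vanishes when `w` is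
  -- orthogonal to both `u` and `v`.
  ⊥⇒∥⨯ : ∀ {w u v} → ¬ Zero w → ¬ Zero (u ⨯ v) → w ⊥ u → w ⊥ v → w ∥ u ⨯ v
  ⊥⇒∥⨯ {l , m , n} {x , y , z} {x′ , y′ , z′} w≉0 u⨯v≉0 w⊥u w⊥v = ⨯≈0⇒∥ w≉0 u⨯v≉0
    ( trans (solve 9 (λ l m n x y z x′ y′ z′ →
        m :* (x :* y′ :- y :* x′) :- n :* (z :* x′ :- x :* z′) :=
        x :* (l :* x′ :+ m :* y′ :+ n :* z′) :- x′ :* (l :* x :+ m :* y :+ n :* z))
        refl l m n x y z x′ y′ z′) (vanish x x′)
    , trans (solve 9 (λ l m n x y z x′ y′ z′ →
        n :* (y :* z′ :- z :* y′) :- l :* (x :* y′ :- y :* x′) :=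
        y :* (l :* x′ :+ m :* y′ :+ n :* z′) :- y′ :* (l :* x :+ m :* y :+ n :* z))
        refl l m n x y z x′ y′ z′) (vanish y y′)
    , trans (solve 9 (λ l m n x y z x′ y′ z′ →
        l :* (z :* x′ :- x :* z′) :- m :* (y :* z′ :- z :* y′) :=
        z :* (l :* x′ :+ m :* y′ :+ n :* z′) :- z′ :* (l :* x :+ m :* y :+ n :* z))
        refl l m n x y z x′ y′ z′) (vanish z z′))
    where
    vanish : ∀ s t → s * (l * x′ + m * y′ + n * z′) - t * (l * x + m * y + n * z) ≈ 0#
    vanish s t = trans
      (+-cong (trans (*-congˡ w⊥v) (zeroʳ s)) (-‿cong (trans (*-congˡ w⊥u) (zeroʳ t))))
      (-‿inverseʳ 0#)

  -- Both `w` and `t` are proportional to `u ⨯ v`, which is nonzero because `u` and `v` are not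
  -- proportional.
  ⊥-unique : ∀ {u v w t} → ¬ Zero u → ¬ Zero v → ¬ Zero w → ¬ Zero t → ¬ u ∥ v →
             w ⊥ u → w ⊥ v → t ⊥ u → t ⊥ v → w ∥ t
  ⊥-unique {u} {v} u≉0 v≉0 w≉0 t≉0 u∦v w⊥u w⊥v t⊥u t⊥v with zero? (u ⨯ v)
  ... | yes u⨯v≈0 = contradiction (⨯≈0⇒∥ u≉0 v≉0 u⨯v≈0) u∦v
  ... | no  u⨯v≉0 = ∥-trans (⊥⇒∥⨯ w≉0 u⨯v≉0 w⊥u w⊥v) (∥-sym (⊥⇒∥⨯ t≉0 u⨯v≉0 t⊥u t⊥v))

  ⊥-sym : ∀ {u v} → u ⊥ v → v ⊥ u
  ⊥-sym u⊥v = trans (+-cong (+-cong (*-comm _ _) (*-comm _ _)) (*-comm _ _)) u⊥v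

  ⊥-resp-∥ : ∀ {u v w} → u ∥ v → v ⊥ w → u ⊥ w
  ⊥-resp-∥ {l , m , n} {l′ , m′ , n′} {x , y , z} (k , _ , l≈ , m≈ , n≈) v⊥w = begin
    l * x + m * y + n * z
      ≈⟨ +-cong (+-cong (*-congʳ l≈) (*-congʳ m≈)) (*-congʳ n≈) ⟩
    k * l′ * x + k * m′ * y + k * n′ * z
      ≈⟨ solve 7 (λ k l m n x y z →
           k :* l :* x :+ k :* m :* y :+ k :* n :* z := k :* (l :* x :+ m :* y :+ n :* z))
           refl k l′ m′ n′ x y z ⟩
    k * (l′ * x + m′ * y + n′ * z)
      ≈⟨ trans (*-congˡ v⊥w) (zeroʳ k) ⟩
    0# ∎

  line-unique : ∀ ℓ₀ m A B → ¬ A ≈ᵖ B → A on ℓ₀ → B on ℓ₀ → A on m → B on m → ℓ₀ ≈ˡ m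
  line-unique ℓ₀ m A B =
    ⊥-unique (Point.nonzero A) (Point.nonzero B) (Line.nonzero ℓ₀) (Line.nonzero m)

  point-unique : ∀ ℓ₀ m A B → ¬ ℓ₀ ≈ˡ m → A on ℓ₀ → A on m → B on ℓ₀ → B on m → A ≈ᵖ B
  point-unique ℓ₀ m A B ℓ₀≉m Aℓ₀ Am Bℓ₀ Bm =
    ⊥-unique (Line.nonzero ℓ₀) (Line.nonzero m) (Point.nonzero A) (Point.nonzero B) ℓ₀≉m
      (⊥-sym Aℓ₀) (⊥-sym Am) (⊥-sym Bℓ₀) (⊥-sym Bm)

  on-respᵖ : ∀ ℓ₀ A B → A ≈ᵖ B → B on ℓ₀ → A on ℓ₀
  on-respᵖ _ _ _ A≈B Bℓ₀ = ⊥-sym (⊥-resp-∥ A≈B (⊥-sym Bℓ₀))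

  -- Diagonals of a quadrilateral.

  -- The vertices A, B, C, D lie on consecutive lines of the quadrilateral
  -- a, b, c, d, and the diagonals AC and BD meet in X.
  record Diagonals {u} (𝒰 : Pred Point u) (a b c d : Line) : Set (f ⊔ ℓ ⊔ u) where
    field
      A B C D X : Point
      AC BD     : Line
      Aa : A on a
      Ab : A on b
      Bb : B on b
      Bc : B on c
      Cc : C on c
      Cd : C on d
      Dd : D on d
      Da : D on a
      AC-joins : AC joins A and C
      BD-joins : BD joins B and D
      X∈𝒰 : X ∈ 𝒰
      X∈AC : X on AC
      X∈BD : X on BD

  -- Consecutive sides are distinct lines, so each corner is their only common point and agrees with
  -- the given one. Quantifying over `m` allows any known equation of a diagonal to be substituted.
  diagonal-point : ∀ {u} {𝒰 : Pred Point u} {a b c d A′ B′ C′ D′} → Diagonals 𝒰 a b c d →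
    ¬ a ≈ˡ b → ¬ b ≈ˡ c → ¬ c ≈ˡ d → ¬ d ≈ˡ a →
    A′ on a → A′ on b → B′ on b → B′ on c → C′ on c → C′ on d → D′ on d → D′ on a →
    ∃[ X ] (X ∈ 𝒰 × (∀ m → A′ on m → C′ on m → X on m) × (∀ m → B′ on m → D′ on m → X on m))
  diagonal-point {a = a} {b} {c} {d} {A′} {B′} {C′} {D′} δ a≉b b≉c c≉d d≉a
                 A′a A′b B′b B′c C′c C′d D′d D′a =
      X , X∈𝒰
    , on-diagonal AC A C AC-joins X∈AC A′ C′
        (point-unique a b A A′ a≉b Aa Ab A′a A′b)
        (point-unique c d C C′ c≉d Cc Cd C′c C′d)
    , on-diagonal BD B D BD-joins X∈BD B′ D′
        (point-unique b c B B′ b≉c Bb Bc B′b B′c)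
        (point-unique d a D D′ d≉a Dd Da D′d D′a)
    where
    open Diagonals δ
    on-diagonal : ∀ ℓ₀ A C → ℓ₀ joins A and C → X on ℓ₀ → ∀ A′ C′ → A ≈ᵖ A′ → C ≈ᵖ C′ →
                  ∀ m → A′ on m → C′ on m → X on m
    on-diagonal ℓ₀ A C (A≉C , Aℓ₀ , Cℓ₀) Xℓ₀ A′ C′ A≈A′ C≈C′ m A′m C′m =
      ⊥-resp-∥ (∥-sym (line-unique ℓ₀ m A C A≉C Aℓ₀ Cℓ₀
        (on-respᵖ m A A′ A≈A′ A′m) (on-respᵖ m C C′ C≈C′ C′m))) Xℓ₀

  -- Lines of a Triple O'Nan as edges of the complete graph.

  module _ {u} {𝒰 : Pred Point u} (T : TripleONan 𝒰) where
    open TripleONan T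
    open K₄

    record Spans (e : Edge) (ℓ₀ : Line) : Set (f ⊔ ℓ) where
      field
        ends-distinct : ¬ vertex (source e) ≈ᵖ vertex (target e)
        ends-on : ∀ v → e ∋ v → vertex v on ℓ₀
    open Spans

    spanning-edge : ∀ {ℓ₀} → ℓ₀ ∈ lines → ∃[ e ] Spans e ℓ₀
    spanning-edge (i , j , i≢j , vᵢ≉vⱼ , vᵢℓ₀ , vⱼℓ₀) with joining i j i≢j
    ... | e , inj₁ (≡.refl , ≡.refl) = e , record
      { ends-distinct = vᵢ≉vⱼ
      ; ends-on = λ { _ (inj₁ ≡.refl) → vᵢℓ₀ ; _ (inj₂ ≡.refl) → vⱼℓ₀ } }
    ... | e , inj₂ (≡.refl , ≡.refl) = e , record
      { ends-distinct = vᵢ≉vⱼ ∘ ∥-sym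
      ; ends-on = λ { _ (inj₁ ≡.refl) → vⱼℓ₀ ; _ (inj₂ ≡.refl) → vᵢℓ₀ } }

    spans-unique : ∀ {e f ℓ₀ m} → Spans e ℓ₀ → Spans f m → e ≡ f → ℓ₀ ≈ˡ m
    spans-unique {e} {ℓ₀ = ℓ₀} {m} s t ≡.refl =
      line-unique ℓ₀ m (vertex (source e)) (vertex (target e)) (ends-distinct s)
      (ends-on s (source e) (inj₁ ≡.refl)) (ends-on s (target e) (inj₂ ≡.refl))
      (ends-on t _ (inj₁ ≡.refl)) (ends-on t _ (inj₂ ≡.refl))

    spans-concurrent : ∀ {e f g a b c} → Spans e a → Spans f b → Spans g c →
                       Concurrentₑ e f g → Concurrent a b c
    spans-concurrent s t r (v , ev , fv , gv) =
      vertex v , ends-on s v ev , ends-on t v fv , ends-on r v gv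

    apart : ∀ e {v w} → e ∋ v → opposite e ∋ w → v ≢ w
    apart e ev e′w ≡.refl = opposite-disjoint e _ ev e′w

    -- The corners of the 4-cycle are all four vertices, and its two diagonals join the pairs of the
    -- remaining partition. The Triple O'Nan supplies their common point in `𝒰`.
    diagonals : ∀ {e f g h a b c d} → Spans e a → Spans f b → Spans g c → Spans h d →
                e ≢ f → e ≢ h → g ≡ opposite e → h ≡ opposite f → Diagonals 𝒰 a b c d
    diagonals {e} {f} ea fb gc hd e≢f e≢h ≡.refl ≡.refl
      with corners e f e≢f
             -- If `f` were `opposite e`, then `opposite f`, which is `h`, would be `e`.
             (λ f≡ → e≢h (≡.trans (≡.sym (Fin.opposite-involutive e)) (≡.cong opposite (≡.sym f≡))))
    ... | (i , eA , fA) , (j , fB , gB) , (k , gC , hC) , (l , hD , eD)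
      with diagonal∈𝒰 i k j l (apart e eA gC) (apart e eA gB) (apart f fA hD)
             (≡.≢-sym (apart f fB hC)) (≡.≢-sym (apart e eD gC)) (≡.≢-sym (apart e eD gB))
    ... | m , n , X , mAC , nBD , X∈𝒰 , Xm , Xn = record
      { A = vertex i ; B = vertex j ; C = vertex k ; D = vertex l ; X = X ; AC = m ; BD = n
      ; Aa = ends-on ea i eA ; Ab = ends-on fb i fA ; Bb = ends-on fb j fB ; Bc = ends-on gc j gB
      ; Cc = ends-on gc k gC ; Cd = ends-on hd k hC ; Dd = ends-on hd l hD ; Da = ends-on ea l eD
      ; AC-joins = mAC ; BD-joins = nBD ; X∈𝒰 = X∈𝒰 ; X∈AC = Xm ; X∈BD = Xn }

    -- No three of the four lines are concurrent, so `two-matchings` applies to their edges. The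
    -- three cases have `L 1F`, `L 2F` and `L 3F` opposite `L 0F`.
    onan-diagonals : ∀ {L} → IsONan 𝒰 L → Extends T L →
                     Diagonals 𝒰 (L 0F) (L 2F) (L 1F) (L 3F) ⊎
                     Diagonals 𝒰 (L 0F) (L 1F) (L 2F) (L 3F) ⊎
                     Diagonals 𝒰 (L 0F) (L 1F) (L 3F) (L 2F)
    onan-diagonals {L} onan ext =
      [ (λ (1≡ , 3≡) → inj₁ (ordered 0F 2F 1F 3F (λ ()) (λ ()) 1≡ 3≡))
      , [ (λ (2≡ , 3≡) → inj₂ (inj₁ (ordered 0F 1F 2F 3F (λ ()) (λ ()) 2≡ 3≡)))
        , (λ (3≡ , 2≡) → inj₂ (inj₂ (ordered 0F 1F 3F 2F (λ ()) (λ ()) 3≡ 2≡)))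
        ]′ ]′
      (two-matchings (edge 0F) (edge 1F) (edge 2F) (edge 3F)
        (e≢ λ ()) (e≢ λ ()) (e≢ λ ()) (e≢ λ ()) (e≢ λ ()) (e≢ λ ())
        (¬conc (λ ()) (λ ()) (λ ())) (¬conc (λ ()) (λ ()) (λ ()))
        (¬conc (λ ()) (λ ()) (λ ())) (¬conc (λ ()) (λ ()) (λ ())))
      where
      open IsONan onan
      edge : Fin 4 → Edge
      edge i = proj₁ (spanning-edge (ext i))
      spans : ∀ i → Spans (edge i) (L i)
      spans i = proj₂ (spanning-edge (ext i))
      e≢ : ∀ {i j} → i ≢ j → edge i ≢ edge j
      e≢ {i} {j} i≢j = distinct i j i≢j ∘ spans-unique (spans i) (spans j)
      ¬conc : ∀ {i j k} → i ≢ j → i ≢ k → j ≢ k → ¬ Concurrentₑ (edge i) (edge j) (edge k)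
      ¬conc {i} {j} {k} i≢j i≢k j≢k =
        quadrilateral i j k i≢j i≢k j≢k ∘ spans-concurrent (spans i) (spans j) (spans k)
      ordered : ∀ i j k l → i ≢ j → i ≢ l →
                edge k ≡ opposite (edge i) → edge l ≡ opposite (edge j) →
                Diagonals 𝒰 (L i) (L j) (L k) (L l)
      ordered i j k l i≢j i≢l = diagonals (spans i) (spans j) (spans k) (spans l) (e≢ i≢j) (e≢ i≢l)

-- Conjugation over the subfield of order q, and the discriminant.

module BuekenhoutMetzProperties
  {f ℓ} {p k : ℕ} (p-prime : Prime p) (K : FiniteField f ℓ ((p ℕ.^ suc k) ℕ.^ 2)) where

  private
    q : ℕ
    q = p ℕ.^ suc k

  open FieldOperations K hiding (zero)
  open ProjectivePlane K
  open BuekenhoutMetz q K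
  open FieldProperties K
  open FiniteFieldProperties K
  open ProjectiveProperties K
  open IntegerSolver commutativeRing
  open FreshmansDream commutativeSemiring
  open Algebra.Properties.CommutativeSemiring.Exp commutativeSemiring hiding (_^_)
  open Algebra.Properties.Semiring.Mult semiring using (×-congʳ)
  open Algebra.Properties.Ring ring using (-‿involutive; -0#≈0#)
  open Algebra.Properties.AbelianGroup +-abelianGroup using (inverseˡ-unique)
  open Relation.Binary.Reasoning.Setoid ≈-setoid

  characteristic : p · 1# ≈ 0#
  characteristic = ^·1≈0⇒·1≈0 p (suc k) (^·1≈0⇒·1≈0 q 2 order·1≈0)

  ^q-+ : ∀ x y → (x + y) ^ q ≈ x ^ q + y ^ q
  ^q-+ = ^pᵏ-distrib-+ p-prime characteristic (suc k)

  ^q-* : ∀ x y → (x * y) ^ q ≈ x ^ q * y ^ q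
  ^q-* x y = ^-distrib-* x y q

  ^q-‿- : ∀ x → (- x) ^ q ≈ - x ^ q
  ^q-‿- x = inverseˡ-unique _ _ (begin
    (- x) ^ q + x ^ q ≈⟨ ^q-+ (- x) x ⟨
    (- x + x) ^ q     ≈⟨ ^-congˡ q (-‿inverseˡ x) ⟩
    0# ^ q            ≈⟨ 0^ q {{ℕ.m^n≢0 p (suc k) {{prime⇒nonZero p-prime}}}} ⟩
    0#                ∎)

  ^q-involutive : ∀ x → (x ^ q) ^ q ≈ x
  ^q-involutive x = begin
    (x ^ q) ^ q           ≈⟨ ^-assocʳ x q q ⟩
    -- The order `q ℕ.^ 2` unfolds to `q ℕ.* (q ℕ.* 1)`, the exponent in `^order`.
    x ^ (q ℕ.* q)         ≡⟨ ≡.cong (λ m → x ^ (q ℕ.* m)) (ℕ.*-identityʳ q) ⟨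
    x ^ (q ℕ.* (q ℕ.* 1)) ≈⟨ ^order x ⟩
    x                     ∎

  𝔽q-resp : ∀ {x y} → x ≈ y → x ∈ 𝔽q → y ∈ 𝔽q
  𝔽q-resp x≈y x∈ = trans (^-congˡ q (sym x≈y)) (trans x∈ x≈y)

  𝔽q-+ : ∀ {x y} → x ∈ 𝔽q → y ∈ 𝔽q → x + y ∈ 𝔽q
  𝔽q-+ {x} {y} x∈ y∈ = trans (^q-+ x y) (+-cong x∈ y∈)

  𝔽q-* : ∀ {x y} → x ∈ 𝔽q → y ∈ 𝔽q → x * y ∈ 𝔽q
  𝔽q-* {x} {y} x∈ y∈ = trans (^q-* x y) (*-cong x∈ y∈)

  𝔽q-neg : ∀ {x} → x ∈ 𝔽q → - x ∈ 𝔽q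
  𝔽q-neg {x} x∈ = trans (^q-‿- x) (-‿cong x∈)

  trace∈𝔽q : ∀ x → x + x ^ q ∈ 𝔽q
  trace∈𝔽q x = trans (^q-+ x (x ^ q)) (trans (+-congˡ (^q-involutive x)) (+-comm _ _))

  ^[q+1] : ∀ x → x ^ (q ℕ.+ 1) ≈ x ^ q * x
  ^[q+1] x = trans (^-homo-* x q 1) (*-congˡ (*-identityʳ x))

  norm∈𝔽q : ∀ x → x ^ (q ℕ.+ 1) ∈ 𝔽q
  norm∈𝔽q x = begin
    (x ^ (q ℕ.+ 1)) ^ q   ≈⟨ ^-congˡ q (^[q+1] x) ⟩
    (x ^ q * x) ^ q       ≈⟨ ^q-* (x ^ q) x ⟩
    (x ^ q) ^ q * x ^ q   ≈⟨ *-congʳ (^q-involutive x) ⟩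
    x * x ^ q             ≈⟨ *-comm _ _ ⟩
    x ^ q * x             ≈⟨ ^[q+1] x ⟨
    x ^ (q ℕ.+ 1)         ∎

  -- The denominator of x[ λ₀ ] always lies in 𝔽q, so the numerator does too,
  -- which gives a ^ q - b ≈ a - b ^ q.
  discriminant-square : ∀ a b {λ₀} → λ₀ ∈ 𝔽q → x[_] a b λ₀ ≉ 0# → x[_] a b λ₀ ∈ 𝔽q →
                        (a + a ^ q) * (a + a ^ q) ≈ discriminant a b
  discriminant-square a b {λ₀} λ₀∈ x≉0 x∈ = sym (begin
    (b - b ^ q) ^ 2 + 4 · a ^ (q ℕ.+ 1)
      ≈⟨ +-cong (^-congˡ 2 b-bᵠ) (×-congʳ 4 (^[q+1] a)) ⟩
    (a ^ q - a) ^ 2 + 4 · (a ^ q * a)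
      -- The nested product and sum on the left are the unfoldings of `_^ 2` and `4 ·_`.
      ≈⟨ solve 2 (λ a a′ → let s = a′ :- a; t = a′ :* a in
           s :* (s :* :1) :+ (t :+ (t :+ (t :+ (t :+ :0)))) := (a :+ a′) :* (a :+ a′))
           refl a (a ^ q) ⟩
    (a + a ^ q) * (a + a ^ q) ∎)
    where
    u = a ^ q + λ₀ - b
    N = a ^ (q ℕ.+ 1) - (λ₀ - b) ^ (q ℕ.+ 1)
    N≉0 : N ≉ 0#
    N≉0 N≈0 = x≉0 (trans (-‿cong (trans (*-congˡ (⁻¹-0 N≈0)) (zeroʳ u))) -0#≈0#)
    u≈-xN : - (x[_] a b λ₀ * N) ≈ u
    u≈-xN = begin
      - (- (u * N ⁻¹) * N) ≈⟨ solve 3 (λ u n n′ → :- (:- (u :* n′) :* n) := u :* (n :* n′))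
                                refl u N (N ⁻¹) ⟩
      u * (N * N ⁻¹)       ≈⟨ trans (*-congˡ (⁻¹-inverseʳ N N≉0)) (*-identityʳ u) ⟩
      u                    ∎
    u∈ : u ∈ 𝔽q
    u∈ = 𝔽q-resp u≈-xN (𝔽q-neg (𝔽q-* x∈ (𝔽q-+ (norm∈𝔽q a) (𝔽q-neg (norm∈𝔽q (λ₀ - b))))))
    uᵠ : u ^ q ≈ a + λ₀ - b ^ q
    uᵠ = trans (^q-+ (a ^ q + λ₀) (- b))
      (+-cong (trans (^q-+ (a ^ q) λ₀) (+-cong (^q-involutive a) λ₀∈)) (^q-‿- b))
    b-bᵠ : b - b ^ q ≈ a ^ q - a
    b-bᵠ = begin
      b - b ^ q
        ≈⟨ solve 4 (λ a b b′ λ₀ → b :- b′ := (a :+ λ₀ :- b′) :+ b :- (a :+ λ₀)) refl a b (b ^ q) λ₀ ⟩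
      (a + λ₀ - b ^ q) + b - (a + λ₀)
        ≈⟨ +-congʳ (+-congʳ (trans (sym uᵠ) u∈)) ⟩
      (a ^ q + λ₀ - b) + b - (a + λ₀)
        ≈⟨ solve 4 (λ a a′ b λ₀ → (a′ :+ λ₀ :- b) :+ b :- (a :+ λ₀) := a′ :- a) refl a (a ^ q) b λ₀ ⟩
      a ^ q - a ∎

  -- The axis of `σ`, the lines through its centre (1,0,0), and the unital.

  vertical : Line
  vertical = line 1# 0# 0# λ (1≈0 , _) → 1≉0 1≈0

  -- Parametrised by `s` so as to join `affine s (- s)` to its image under `σ`.
  horizontal : Carrier → Line
  horizontal s = line 0# 1# s λ (_ , 1≈0 , _) → 1≉0 1≈0

  on-vertical : ∀ {x y} → affine x y on vertical → x ≈ 0#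
  on-vertical {x} {y} e =
    trans (solve 2 (λ x y → x := :1 :* x :+ :0 :* y :+ :0 :* :1) refl x y) e

  on-horizontal : ∀ {x y s} → affine x y on horizontal s → y ≈ - s
  on-horizontal {x} {y} {s} e = inverseˡ-unique y s
    (trans (solve 3 (λ x y s → y :+ s := :0 :* x :+ :1 :* y :+ s :* :1) refl x y s) e)

  T∞-off-horizontal : ∀ {s} → ¬ T∞ on horizontal s
  T∞-off-horizontal {s} e = 1≉0
    (trans (solve 1 (λ s → :1 := :0 :* :0 :+ :1 :* :1 :+ s :* :0) refl s) e)

  module _ {a b : Carrier} where

    -- At x = 0 the terms in `a` and `b` vanish, so an affine point of the unital there has second
    -- coordinate `ρ` in `𝔽q`. The point `T∞` is on no horizontal line.
    vertical∩horizontal : ∀ {X s} → X ∈ unital a b → X on vertical → X on horizontal s → s ∈ 𝔽q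
    vertical∩horizontal {X} {s} (inj₂ X≈) v h =
      contradiction (on-respᵖ (horizontal s) T∞ X (∥-sym X≈) h) (T∞-off-horizontal {s})
    vertical∩horizontal {X} {s} (inj₁ (x , ρ , ρ∈ , X≈)) v h = 𝔽q-resp -ρ≈s (𝔽q-neg ρ∈)
      where
      y = a * x ^ 2 + b * x ^ (q ℕ.+ 1) + ρ
      x≈0 : x ≈ 0#
      x≈0 = on-vertical {x} {y} (on-respᵖ vertical (affine x y) X (∥-sym X≈) v)
      y≈-s : y ≈ - s
      y≈-s = on-horizontal {x} {y} {s} (on-respᵖ (horizontal s) (affine x y) X (∥-sym X≈) h)
      y≈ρ : y ≈ ρ
      y≈ρ = begin
        a * x ^ 2 + b * x ^ (q ℕ.+ 1) + ρ
          ≈⟨ +-congʳ (+-cong (*-congˡ (*-congʳ x≈0)) (*-congˡ (trans (^[q+1] x) (*-congˡ x≈0)))) ⟩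
        a * (0# * (x * 1#)) + b * (x ^ q * 0#) + ρ
          ≈⟨ solve 5 (λ a b x x′ ρ → a :* (:0 :* (x :* :1)) :+ b :* (x′ :* :0) :+ ρ := ρ)
               refl a b x (x ^ q) ρ ⟩
        ρ ∎
      -ρ≈s : - ρ ≈ s
      -ρ≈s = trans (-‿cong (trans (sym y≈ρ) y≈-s)) (-‿involutive s)

    -- An affine point on a horizontal line determines its parameter as minus the second coordinate,
    -- and `T∞` is on no such line.
    horizontal∩horizontal : ∀ {X s t} → X ∈ unital a b → X on horizontal s → X on horizontal t → s ≈ t
    horizontal∩horizontal {X} {s} (inj₂ X≈) h h′ =
      contradiction (on-respᵖ (horizontal s) T∞ X (∥-sym X≈) h) (T∞-off-horizontal {s})
    horizontal∩horizontal {X} {s} {t} (inj₁ (x , ρ , _ , X≈)) h h′ =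
      trans (sym (-‿involutive s)) (trans (-‿cong (trans (sym (y≈- h)) (y≈- h′))) (-‿involutive t))
      where
      y = a * x ^ 2 + b * x ^ (q ℕ.+ 1) + ρ
      y≈- : ∀ {s} → X on horizontal s → y ≈ - s
      y≈- {s} h = on-horizontal {x} {y} {s} (on-respᵖ (horizontal s) (affine x y) X (∥-sym X≈) h)

  -- Incidences and diagonals of the Feng-Li quadrilateral.

  P-on-ℓ₁ : ∀ s → affine s (- s) on ℓ₁
  P-on-ℓ₁ = solve 1 (λ s → :1 :* s :+ :1 :* :- s :+ :0 :* :1 := :0) refl

  σP-on-ℓ₋₁ : ∀ s → σ (affine s (- s)) on ℓ₋₁
  σP-on-ℓ₋₁ = solve 1 (λ s → :1 :* :- s :+ :- :1 :* :- s :+ :0 :* :1 := :0) refl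

  P-on-horizontal : ∀ s → affine s (- s) on horizontal s
  P-on-horizontal = solve 1 (λ s → :0 :* s :+ :1 :* :- s :+ s :* :1 := :0) refl

  σP-on-horizontal : ∀ s → σ (affine s (- s)) on horizontal s
  σP-on-horizontal = solve 1 (λ s → :0 :* :- s :+ :1 :* :- s :+ s :* :1 := :0) refl

  affine0-on-vertical : ∀ y → affine 0# y on vertical
  affine0-on-vertical = solve 1 (λ y → :1 :* :0 :+ :0 :* y :+ :0 :* :1 := :0) refl

  origin : Point
  origin = affine 0# 0#

  origin-on-ℓ₁ : origin on ℓ₁
  origin-on-ℓ₁ = solve 0 (:1 :* :0 :+ :1 :* :0 :+ :0 :* :1 := :0) refl

  origin-on-ℓ₋₁ : origin on ℓ₋₁
  origin-on-ℓ₋₁ = solve 0 (:1 :* :0 :+ :- :1 :* :0 :+ :0 :* :1 := :0) refl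

  -- The triple (0, ρ, 1) scaled by s + t equals t (s, -s, 1) + s (-t, -t, 1), a combination of two
  -- points of the line.
  secant-meets-vertical : ∀ {s t ρ} ℓ₀ → s + t ≉ 0# → (s + t) * ρ ≈ - (2 · (s * t)) →
    affine s (- s) on ℓ₀ → σ (affine t (- t)) on ℓ₀ → affine 0# ρ on ℓ₀
  secant-meets-vertical {s} {t} {ρ} (line l m n _) s+t≉0 ρ-eq Pₛ Pₜ = *≈0⇒≈0ʳ s+t≉0 (begin
    (s + t) * (l * 0# + m * ρ + n * 1#)
      ≈⟨ solve 6 (λ s t ρ l m n → (s :+ t) :* (l :* :0 :+ m :* ρ :+ n :* :1) :=
           m :* ((s :+ t) :* ρ) :+ (s :+ t) :* n) refl s t ρ l m n ⟩
    m * ((s + t) * ρ) + (s + t) * n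
      ≈⟨ +-congʳ (*-congˡ ρ-eq) ⟩
    m * - (2 · (s * t)) + (s + t) * n
      ≈⟨ solve 5 (λ s t l m n →
           m :* :- (s :* t :+ (s :* t :+ :0)) :+ (s :+ t) :* n :=
           t :* (l :* s :+ m :* :- s :+ n :* :1) :+ s :* (l :* :- t :+ m :* :- t :+ n :* :1))
           refl s t l m n ⟩
    t * (l * s + m * - s + n * 1#) + s * (l * - t + m * - t + n * 1#)
      ≈⟨ +-cong (trans (*-congˡ Pₛ) (zeroʳ t)) (trans (*-congˡ Pₜ) (zeroʳ s)) ⟩
    0# + 0#
      ≈⟨ +-identityˡ 0# ⟩
    0# ∎)

  -- Here `s` and `t` stand for x₁ and x₂, and `ρ` for the second coordinate of R.
  module _ {a b s t ρ : Carrier} {ℓ′ ℓ″ : Line}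
           (onan : IsONan (unital a b) (ℓ₁ ∷ ℓ₋₁ ∷ ℓ′ ∷ ℓ″ ∷ []))
           (s+t≉0 : s + t ≉ 0#) (ρ-eq : (s + t) * ρ ≈ - (2 · (s * t)))
           (Pₛℓ′ : affine s (- s) on ℓ′) (σPₜℓ′ : σ (affine t (- t)) on ℓ′)
           (σPₛℓ″ : σ (affine s (- s)) on ℓ″) (Pₜℓ″ : affine t (- t) on ℓ″) where
    open IsONan onan

    private
      𝒰 : Pred Point (f ⊔ ℓ)
      𝒰 = unital a b

      L : Vector Line 4
      L = ℓ₁ ∷ ℓ₋₁ ∷ ℓ′ ∷ ℓ″ ∷ []

      Pₛ Pₜ : Point
      Pₛ = affine s (- s)
      Pₜ = affine t (- t)

      R : Point
      R = affine 0# ρ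

      Rℓ′ : R on ℓ′
      Rℓ′ = secant-meets-vertical {s} {t} ℓ′ s+t≉0 ρ-eq Pₛℓ′ σPₜℓ′

      Rℓ″ : R on ℓ″
      -- The line `ℓ″` joins `Pₜ` to the mirror image of `Pₛ`, so `s` and `t` exchange roles.
      Rℓ″ = secant-meets-vertical {t} {s} ℓ″ (s+t≉0 ∘ trans (+-comm s t))
        (trans (*-congʳ (+-comm t s)) (trans ρ-eq (-‿cong (×-congʳ 2 (*-comm s t))))) Pₜℓ″ σPₛℓ″

      -- Otherwise `Pₛ` and `Pₜ` would coincide in a common point of `ℓ₁`, `ℓ′` and `ℓ″`.
      s≉t : s ≉ t
      s≉t s≈t = quadrilateral 0F 2F 3F (λ ()) (λ ()) (λ ())
        (Pₛ , P-on-ℓ₁ s , Pₛℓ′ , on-respᵖ ℓ″ Pₛ Pₜ Pₛ≈Pₜ Pₜℓ″)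
        where
        Pₛ≈Pₜ : Pₛ ≈ᵖ Pₜ
        Pₛ≈Pₜ = 1# , 1≉0 , trans s≈t (sym (*-identityˡ t))
              , trans (-‿cong s≈t) (sym (*-identityˡ (- t))) , sym (*-identityˡ 1#)

      diagonals⇒∈𝔽q : Diagonals 𝒰 ℓ₁ ℓ′ ℓ₋₁ ℓ″ ⊎
                      Diagonals 𝒰 ℓ₁ ℓ₋₁ ℓ′ ℓ″ ⊎
                      Diagonals 𝒰 ℓ₁ ℓ₋₁ ℓ″ ℓ′ →
                      s ∈ 𝔽q ⊎ t ∈ 𝔽q
      -- With `ℓ₋₁` opposite `ℓ₁`, the diagonals are y = -s and y = -t.
      diagonals⇒∈𝔽q (inj₁ δ) =
        let X , X∈ , ac , bd = diagonal-point {𝒰 = 𝒰} {ℓ₁} {ℓ′} {ℓ₋₁} {ℓ″} {Pₛ} {σ Pₜ} {σ Pₛ} {Pₜ} δ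
              (distinct 0F 2F λ ()) (distinct 2F 1F λ ()) (distinct 1F 3F λ ()) (distinct 3F 0F λ ())
              (P-on-ℓ₁ s) Pₛℓ′ σPₜℓ′ (σP-on-ℓ₋₁ t) (σP-on-ℓ₋₁ s) σPₛℓ″ Pₜℓ″ (P-on-ℓ₁ t)
        in contradiction (horizontal∩horizontal {a} {b} {X} {s} {t} X∈
            (ac (horizontal s) (P-on-horizontal s) (σP-on-horizontal s))
            (bd (horizontal t) (σP-on-horizontal t) (P-on-horizontal t))) s≉t
      -- With `ℓ′` opposite `ℓ₁`, the diagonals are x = 0, through `origin` and `R`, and y = -t.
      diagonals⇒∈𝔽q (inj₂ (inj₁ δ)) =
        let X , X∈ , ac , bd = diagonal-point {𝒰 = 𝒰} {ℓ₁} {ℓ₋₁} {ℓ′} {ℓ″} {origin} {σ Pₜ} {R} {Pₜ} δ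
              (distinct 0F 1F λ ()) (distinct 1F 2F λ ()) (distinct 2F 3F λ ()) (distinct 3F 0F λ ())
              origin-on-ℓ₁ origin-on-ℓ₋₁ (σP-on-ℓ₋₁ t) σPₜℓ′ Rℓ′ Rℓ″ Pₜℓ″ (P-on-ℓ₁ t)
        in inj₂ (vertical∩horizontal {a} {b} {X} {t} X∈
            (ac vertical (affine0-on-vertical 0#) (affine0-on-vertical ρ))
            (bd (horizontal t) (σP-on-horizontal t) (P-on-horizontal t)))
      -- With `ℓ″` opposite `ℓ₁`, they are x = 0 and y = -s.
      diagonals⇒∈𝔽q (inj₂ (inj₂ δ)) =
        let X , X∈ , ac , bd = diagonal-point {𝒰 = 𝒰} {ℓ₁} {ℓ₋₁} {ℓ″} {ℓ′} {origin} {σ Pₛ} {R} {Pₛ} δ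
              (distinct 0F 1F λ ()) (distinct 1F 3F λ ()) (distinct 3F 2F λ ()) (distinct 2F 0F λ ())
              origin-on-ℓ₁ origin-on-ℓ₋₁ (σP-on-ℓ₋₁ s) σPₛℓ″ Rℓ″ Rℓ′ Pₛℓ′ (P-on-ℓ₁ s)
        in inj₁ (vertical∩horizontal {a} {b} {X} {s} X∈
            (ac vertical (affine0-on-vertical 0#) (affine0-on-vertical ρ))
            (bd (horizontal s) (σP-on-horizontal s) (P-on-horizontal s)))

    extendable⇒∈𝔽q : ∃[ T ] Extends {𝒰 = 𝒰} T L → s ∈ 𝔽q ⊎ t ∈ 𝔽q
    extendable⇒∈𝔽q (T , ext) = diagonals⇒∈𝔽q (onan-diagonals T {L} onan ext)

  -- From the Feng-Li parameters to the conclusion.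

  harmonic-mean : ∀ {s t} → s + t ≉ 0# → (s + t) * - (2 · (s * t) / (s + t)) ≈ - (2 · (s * t))
  harmonic-mean {s} {t} s+t≉0 = begin
    (s + t) * - (2 · (s * t) / (s + t))
      ≈⟨ solve 3 (λ u v w → u :* :- (v :* w) := :- (v :* (u :* w)))
           refl (s + t) (2 · (s * t)) ((s + t) ⁻¹) ⟩
    - (2 · (s * t) * ((s + t) / (s + t)))
      ≈⟨ -‿cong (trans (*-congˡ (⁻¹-inverseʳ _ s+t≉0)) (*-identityʳ _)) ⟩
    - (2 · (s * t)) ∎

  -- Turns `r≉0` into the nonvanishing of both x₁ and x₂, which `discriminant-square` requires.
  harmonic-mean≉0 : ∀ {s t} → - (2 · (s * t) / (s + t)) ≉ 0# → s * t ≉ 0#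
  harmonic-mean≉0 {s} {t} r≉0 st≈0 = r≉0 (begin
    - (2 · (s * t) / (s + t)) ≈⟨ -‿cong (*-congʳ (×-congʳ 2 st≈0)) ⟩
    - (2 · 0# / (s + t))      ≈⟨ solve 1 (λ w → :- ((:0 :+ (:0 :+ :0)) :* w) := :0) refl ((s + t) ⁻¹) ⟩
    0#                        ∎)

  not-extendable : ∀ {a b} (F : FengLi a b) → IsONan (unital a b) (FengLi.lines F) →
                   NonSquareIn𝔽q (discriminant a b) →
                   ¬ (∃[ T ] Extends {𝒰 = unital a b} T (FengLi.lines F))
  not-extendable {a} {b} F onan (_ , non-square) extension =
    [ x∉𝔽q λ₁∈𝔽q x₁≉0 , x∉𝔽q λ₂∈𝔽q x₂≉0 ]′
      (extendable⇒∈𝔽q {a} {b} {x₁} {x₂} {r} {ℓ′} {ℓ″} onan sum≉0 (harmonic-mean {x₁} {x₂} sum≉0)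
        (proj₁ (proj₂ ℓ′-join)) (proj₂ (proj₂ ℓ′-join))
        (proj₁ (proj₂ ℓ″-join)) (proj₂ (proj₂ ℓ″-join)) extension)
    where
    open FengLi F
    x₁ x₂ : Carrier
    x₁ = x[_] a b λ₁
    x₂ = x[_] a b λ₂
    x₁≉0 : x₁ ≉ 0#
    x₁≉0 e = harmonic-mean≉0 {x₁} {x₂} r≉0 (trans (*-congʳ e) (zeroˡ x₂))
    x₂≉0 : x₂ ≉ 0#
    x₂≉0 e = harmonic-mean≉0 {x₁} {x₂} r≉0 (trans (*-congˡ e) (zeroʳ x₁))
    x∉𝔽q : ∀ {λ₀} → λ₀ ∈ 𝔽q → x[_] a b λ₀ ≉ 0# → ¬ x[_] a b λ₀ ∈ 𝔽q
    x∉𝔽q λ₀∈ x≉0 x∈ = non-square (a + a ^ q , trace∈𝔽q a , discriminant-square a b λ₀∈ x≉0 x∈)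

theorem4 : ∀ {c ℓ} (q : ℕ) → OddPrimePower q →
    (K : FiniteField c ℓ (q ℕ.^ 2)) →
    let open FieldOperations K
        open ProjectivePlane K
        open BuekenhoutMetz q K in
    (a b : Carrier) → NonSquareIn𝔽q (discriminant a b) → a ≉ 0# →
    (F : FengLi a b) → IsONan (unital a b) (FengLi.lines F) →
    ¬ (∃[ T ] Extends {𝒰 = unital a b} T (FengLi.lines F))
theorem4 _ ((p , k , p-prime , ≡.refl) , _) K a b d-non-square _ F onan =
  BuekenhoutMetzProperties.not-extendable {p = p} {k} p-prime K F onan d-non-square
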